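{- $f_3(k)=O(k^{43})$; that is, there exist constants $C,K$ such that $f_3(k)\leq Ck^{43}$ for all integers $k\geq K$.
   Context: A 3-coloring of a set $A\subseteq\mathbb{N}$ is a function $\Delta:A\to\{0,1,2\}$. For integers $r,k\geq 2$, $f_r(k)$ denotes the smallest positive integer $n$ such that every $r$-coloring $\Delta$ of $\{1,2,\ldots,n\}$ has a monochromatic solution to $1/x_1+\cdots+1/x_k=1/y$, i.e. elements $a_1,\ldots,a_k,b$ (with $a_1,\ldots,a_k$ not necessarily distinct) with $1/a_1+\cdots+1/a_k=1/b$ and $\Delta(a_1)=\cdots=\Delta(a_k)=\Delta(b)$. -}

module Defs where

open import Data.Nat using (ℕ; zero; suc; _≤_)
open import Data.Fin using (Fin; zero; suc; toℕ)
open import Data.Integer using (+_)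
open import Data.Rational using (ℚ; _/_; 0ℚ; _+_)
open import Data.Product using (Σ; _×_)
open import Relation.Binary.PropositionalEquality using (_≡_)

-- The ground set {1,…,n} is represented by Fin n; i : Fin n stands for toℕ i + 1.
elem : ∀ {n} → Fin n → ℕ
elem i = suc (toℕ i)

recip : ∀ {n} → Fin n → ℚ
recip i = + 1 / suc (toℕ i)

sumFin : ∀ k → (Fin k → ℚ) → ℚ
sumFin zero    f = 0ℚ
sumFin (suc k) f = f zero + sumFin k (λ i → f (suc i))

HasMonoSolution : ∀ {r} (k n : ℕ) → (Fin n → Fin r) → Set
HasMonoSolution k n Δ =
  Σ (Fin k → Fin n) λ a → Σ (Fin n) λ b →
    (sumFin k (λ i → recip (a i)) ≡ recip b) × (∀ i → Δ (a i) ≡ Δ b)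

Arrows : (r k n : ℕ) → Set
Arrows r k n = (Δ : Fin n → Fin r) → HasMonoSolution k n Δ

-- f_r(k) ≤ m  (f_r(k) is the least n with Arrows r k n, so this unfolds to
-- the existence of such an n below m)
f≤ : (r k m : ℕ) → Set
f≤ r k m = Σ ℕ λ n → (n ≤ m) × Arrows r k n

{-# OPTIONS --safe #-}

-- If L is a common multiple of a set S of positive integers, then x = L / s turns a solution
-- of s₁ + ⋯ + sₖ = t in S into a solution of 1/x₁ + ⋯ + 1/xₖ = 1/y in {1,…,L}.  So it suffices
-- to find S, consisting of values of polynomials in k with an lcm of small degree, such that
-- every 3-colouring of S has a monochromatic solution of s₁ + ⋯ + sₖ = t.  A set of 28
-- polynomials of degree at most 3 with an lcm of degree 30 does this, using only the solutions
-- (k − b) v + u₁ + ⋯ + u_b = t with b ≤ 2: the resulting finite hypergraph, which does not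
-- depend on k, is not 3-colourable.

module Submission where

open import Defs
open import Data.Nat using (ℕ; _≤_; _*_; _^_)
open import Data.Product using (Σ)

open import Data.Bool using (Bool; true; false; T; if_then_else_; _∧_; _∨_; not)
open import Data.Bool.ListAction using (any; all)
open import Data.Bool.Properties using (T-∧; T-∨; T-≡)
open import Data.Fin as Fin using (Fin; zero; suc; fromℕ<)
import Data.Fin.Properties as Fin
open import Data.Integer using (+_)
import Data.Integer as ℤ
import Data.Integer.Properties as ℤ
open import Data.List using (List; []; _∷_; _++_; map; foldr; length; lookup; replicate; concatMap; filter; filterᵇ;
  zip; upTo; allFin; null; head; drop)
open import Data.List.Membership.Propositional.Properties using (∈-allFin; ∈-lookup)
import Data.List.Properties as List
open import Data.List.Relation.Unary.All as All using (All; []; _∷_)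
import Data.List.Relation.Unary.All.Properties as All
open import Data.List.Relation.Unary.Any as Any using (Any; here; there)
open import Data.Maybe using (fromMaybe)
open import Data.Nat as ℕ using (zero; suc; _+_; _∸_; _⊓_; _≟_; _≤?_; _≡ᵇ_; _<_; z≤n; s≤s; NonZero)
open import Data.Nat.ListAction using (sum)
open import Data.Nat.ListAction.Properties using (sum-++)
open import Data.Nat.Properties
open import Data.Nat.Tactic.RingSolver using (solve-∀)
open import Data.Product using (_×_; _,_; proj₁; proj₂)
open import Data.Rational as ℚ using (_/_)
import Data.Rational.Properties as ℚ
open import Data.Rational.Unnormalised as ℚᵘ using (mkℚᵘ; *≡*)
import Data.Rational.Unnormalised.Properties as ℚᵘ
open import Data.Sum using (inj₁; inj₂)
open import Function using (_∘_; Equivalence)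
open import Relation.Binary.PropositionalEquality using (_≡_; _≢_; refl; sym; trans; cong; cong₂; subst; module ≡-Reasoning)
open import Relation.Nullary using (¬_; Dec; yes; no; does; ¬?; contradiction)
open import Relation.Nullary.Decidable using (toWitness; from-yes; _→-dec_; _×-dec_; decidable-stable; ⌊_⌋)

-- Polynomials with natural coefficients, constant term first

Poly : Set
Poly = List ℕ

infixl 6 _⊕_
infixl 7 _⊗_

⟦_⟧ : Poly → ℕ → ℕ
⟦ []    ⟧ x = 0
⟦ a ∷ p ⟧ x = a + x * ⟦ p ⟧ x

_⊕_ : Poly → Poly → Poly
[]      ⊕ q       = q
(a ∷ p) ⊕ []      = a ∷ p
(a ∷ p) ⊕ (b ∷ q) = a + b ∷ p ⊕ q

_⊗_ : Poly → Poly → Poly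
[]      ⊗ q = []
(a ∷ p) ⊗ q = map (a *_) q ⊕ (0 ∷ p ⊗ q)

Π : List Poly → Poly
Π = foldr _⊗_ (1 ∷ [])

⟦⟧-⊕ : ∀ p q x → ⟦ p ⊕ q ⟧ x ≡ ⟦ p ⟧ x + ⟦ q ⟧ x
⟦⟧-⊕ []      q       x = refl
⟦⟧-⊕ (a ∷ p) []      x = sym (+-identityʳ _)
⟦⟧-⊕ (a ∷ p) (b ∷ q) x rewrite ⟦⟧-⊕ p q x = lemma a b x (⟦ p ⟧ x) (⟦ q ⟧ x)
  where
  lemma : ∀ a b x s t → a + b + x * (s + t) ≡ a + x * s + (b + x * t)
  lemma = solve-∀

⟦⟧-scale : ∀ a q x → ⟦ map (a *_) q ⟧ x ≡ a * ⟦ q ⟧ x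
⟦⟧-scale a []      x = sym (*-zeroʳ a)
⟦⟧-scale a (b ∷ q) x rewrite ⟦⟧-scale a q x = lemma a b x (⟦ q ⟧ x)
  where
  lemma : ∀ a b x t → a * b + x * (a * t) ≡ a * (b + x * t)
  lemma = solve-∀

⟦⟧-⊗ : ∀ p q x → ⟦ p ⊗ q ⟧ x ≡ ⟦ p ⟧ x * ⟦ q ⟧ x
⟦⟧-⊗ []      q x = refl
⟦⟧-⊗ (a ∷ p) q x
  rewrite ⟦⟧-⊕ (map (a *_) q) (0 ∷ p ⊗ q) x | ⟦⟧-scale a q x | ⟦⟧-⊗ p q x
  = lemma a x (⟦ p ⟧ x) (⟦ q ⟧ x)
  where
  lemma : ∀ a x s t → a * t + x * (s * t) ≡ (a + x * s) * t
  lemma = solve-∀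

⟦⟧-foldr-⊕ : ∀ p qs x → ⟦ foldr _⊕_ p qs ⟧ x ≡ ⟦ p ⟧ x + sum (map (λ q → ⟦ q ⟧ x) qs)
⟦⟧-foldr-⊕ p []       x = sym (+-identityʳ _)
⟦⟧-foldr-⊕ p (q ∷ qs) x
  rewrite ⟦⟧-⊕ q (foldr _⊕_ p qs) x | ⟦⟧-foldr-⊕ p qs x
  = lemma (⟦ q ⟧ x) (⟦ p ⟧ x) _
  where
  lemma : ∀ a b c → a + (b + c) ≡ b + (a + c)
  lemma = solve-∀

⟦⟧-mono : ∀ p {x y} → x ≤ y → ⟦ p ⟧ x ≤ ⟦ p ⟧ y
⟦⟧-mono []      x≤y = z≤n
⟦⟧-mono (a ∷ p) x≤y = +-monoʳ-≤ a (*-mono-≤ x≤y (⟦⟧-mono p x≤y))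

-- Each coefficient is charged a full power of `y ≥ 1`; the exponent is the length, one above the
-- formal degree, to keep the induction uniform.
⟦⟧-bound : ∀ p {x y} .{{_ : NonZero y}} → x ≤ y → ⟦ p ⟧ x ≤ sum p * y ^ length p
⟦⟧-bound []              x≤y = z≤n
⟦⟧-bound (a ∷ p) {x} {y} x≤y = begin
  a + x * ⟦ p ⟧ x
    ≤⟨ +-mono-≤ (m≤m*n a (y ^ suc (length p)) {{m^n≢0 y (suc (length p))}}) (*-mono-≤ x≤y (⟦⟧-bound p x≤y)) ⟩
  a * (y * y ^ length p) + y * (sum p * y ^ length p)
    ≡⟨ lemma a y (sum p) (y ^ length p) ⟩
  (a + sum p) * (y * y ^ length p) ∎
  where
  open ≤-Reasoning
  lemma : ∀ a y s t → a * (y * t) + y * (s * t) ≡ (a + s) * (y * t)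
  lemma = solve-∀

-- Selection is by position, so that equal factors can be chosen independently.
select : (ℕ → Bool) → List Poly → List Poly
select P []       = []
select P (p ∷ ps) = if P 0 then p ∷ select (P ∘ suc) ps else select (P ∘ suc) ps

⟦⟧-select : ∀ P ps x →
  ⟦ Π (select P ps) ⟧ x * ⟦ Π (select (not ∘ P) ps) ⟧ x ≡ ⟦ Π ps ⟧ x
⟦⟧-select P []       x rewrite *-zeroʳ x = refl
⟦⟧-select P (p ∷ ps) x with P 0
... | true
  rewrite ⟦⟧-⊗ p (Π (select (P ∘ suc) ps)) x | ⟦⟧-⊗ p (Π ps) x | sym (⟦⟧-select (P ∘ suc) ps x)
  = *-assoc (⟦ p ⟧ x) _ _
... | false
  rewrite ⟦⟧-⊗ p (Π (select (not ∘ P ∘ suc) ps)) x | ⟦⟧-⊗ p (Π ps) x | sym (⟦⟧-select (P ∘ suc) ps x)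
  = lemma (⟦ Π (select (P ∘ suc) ps) ⟧ x) (⟦ p ⟧ x) _
  where
  lemma : ∀ a b c → a * (b * c) ≡ b * (a * c)
  lemma = solve-∀

sum-map-replicate : ∀ {A : Set} (f : A → ℕ) n x → sum (map f (replicate n x)) ≡ n * f x
sum-map-replicate f zero    x = refl
sum-map-replicate f (suc n) x = cong (λ s → f x + s) (sum-map-replicate f n x)

-- Sums of reciprocals with common numerator L

/-+-homo : ∀ l a b → + a / suc l ℚ.+ + b / suc l ≡ + (a + b) / suc l
/-+-homo l a b = ℚ.toℚᵘ-injective (begin
  ℚ.toℚᵘ (+ a / suc l ℚ.+ + b / suc l)                ≈⟨ ℚ.toℚᵘ-homo-+ (+ a / suc l) (+ b / suc l) ⟩
  ℚ.toℚᵘ (+ a / suc l) ℚᵘ.+ ℚ.toℚᵘ (+ b / suc l)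
    ≈⟨ ℚᵘ.+-cong (ℚ.toℚᵘ-fromℚᵘ (mkℚᵘ (+ a) l)) (ℚ.toℚᵘ-fromℚᵘ (mkℚᵘ (+ b) l)) ⟩
  mkℚᵘ (+ a) l ℚᵘ.+ mkℚᵘ (+ b) l                      ≈⟨ *≡* same ⟩
  mkℚᵘ (+ (a + b)) l                                  ≈⟨ ℚ.toℚᵘ-fromℚᵘ (mkℚᵘ (+ (a + b)) l) ⟨
  ℚ.toℚᵘ (+ (a + b) / suc l)                          ∎)
  where
  open ℚᵘ.≃-Reasoning
  same : (+ a ℤ.* + suc l ℤ.+ + b ℤ.* + suc l) ℤ.* + suc l ≡ + (a + b) ℤ.* (+ suc l ℤ.* + suc l)
  same = trans (cong (ℤ._* + suc l) (sym (ℤ.*-distribʳ-+ (+ suc l) (+ a) (+ b))))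
               (ℤ.*-assoc (+ (a + b)) (+ suc l) (+ suc l))

module _ {n l : ℕ} {I : Set} (num : I → ℕ) (den : I → Fin n)
         (num*den : ∀ i → num i * elem (den i) ≡ suc l) where

  recip-den : ∀ i → recip (den i) ≡ + num i / suc l
  recip-den i = ℚ.fromℚᵘ-cong {mkℚᵘ (+ 1) _} {mkℚᵘ (+ num i) l} (*≡* (begin
    + 1 ℤ.* + suc l             ≡⟨ ℤ.*-identityˡ _ ⟩
    + suc l                     ≡⟨ cong +_ (num*den i) ⟨
    + (num i * elem (den i))    ≡⟨ ℤ.pos-* (num i) (elem (den i)) ⟩
    + num i ℤ.* + elem (den i)  ∎))
    where open ≡-Reasoning

  sum-recip : ∀ is → sumFin (length is) (λ t → recip (den (lookup is t))) ≡ + sum (map num is) / suc l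
  sum-recip []       = ℚ.fromℚᵘ-cong {mkℚᵘ (+ 0) 0} {mkℚᵘ (+ 0) l} (*≡* refl)
  sum-recip (i ∷ is) = trans (cong₂ ℚ._+_ (recip-den i) (sum-recip is)) (/-+-homo l (num i) _)

  monochromatic : ∀ {r} (Δ : Fin n → Fin r) is j → sum (map num is) ≡ num j →
    All (λ i → Δ (den i) ≡ Δ (den j)) is → HasMonoSolution (length is) n Δ
  monochromatic Δ is j sum≡ same =
    den ∘ lookup is , den j ,
    trans (sum-recip is) (trans (cong (λ s → + s / suc l) sum≡) (sym (recip-den j))) ,
    λ t → All.lookup same (∈-lookup t)

-- Refuting 3-colourings by exhaustive search

Colour : Set
Colour = Fin 3

-- (c , vs) forbids that all vertices in vs have the colour c.
Clause : Set
Clause = Colour × List ℕ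

Satisfies : (ℕ → Colour) → List Clause → Set
Satisfies χ = All λ (c , vs) → ¬ All (λ v → χ v ≡ c) vs

-- A clause of colour `d` now depends only on its other vertices; a clause of another colour
-- containing `v` already holds.
assign : ℕ → Colour → List Clause → List Clause
assign v d [] = []
assign v d ((c , vs) ∷ cs) with c Fin.≟ d | Any.any? (v ≟_) vs
... | yes _ | _     = (c , filter (λ u → ¬? (u ≟ v)) vs) ∷ assign v d cs
... | no _  | yes _ = assign v d cs
... | no _  | no _  = (c , vs) ∷ assign v d cs

unfilter : ∀ {χ : ℕ → Colour} {v c} → χ v ≡ c → ∀ vs →
  All (λ u → χ u ≡ c) (filter (λ u → ¬? (u ≟ v)) vs) → All (λ u → χ u ≡ c) vs
unfilter {χ} {v} χv≡c vs same = All.filter⁻ ≢v? same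
  (All.map (λ {u} u≡v → trans (cong χ (decidable-stable (u ≟ v) u≡v)) χv≡c) (All.all-filter (¬? ∘ ≢v?) vs))
  where
  ≢v? = λ u → ¬? (u ≟ v)

assign-sound : ∀ {χ v d} → χ v ≡ d → ∀ {cs} → Satisfies χ cs → Satisfies χ (assign v d cs)
assign-sound χv≡d [] = []
assign-sound {v = v} {d} χv≡d {(c , vs) ∷ cs} (s ∷ ss) with c Fin.≟ d | Any.any? (v ≟_) vs
... | yes refl | _     = s ∘ unfilter χv≡d vs ∷ assign-sound χv≡d ss
... | no _     | yes _ = assign-sound χv≡d ss
... | no _     | no _  = s ∷ assign-sound χv≡d ss

units : List Clause → List (Colour × ℕ)
units []                  = []
units ((c , v ∷ []) ∷ cs) = (c , v) ∷ units cs
units (_ ∷ cs)            = units cs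

-- A unit clause excludes one colour at its vertex; two units with different colours leave at most
-- one.
forced : List (Colour × ℕ) → List ℕ
forced [] = []
forced ((c , v) ∷ us) =
  if any (λ (c′ , v′) → (v ≡ᵇ v′) ∧ not (does (c Fin.≟ c′))) us then v ∷ forced us else forced us

least : List ℕ → ℕ
least []       = 0
least (v ∷ vs) = foldr _⊓_ v vs

-- Branch on a vertex with as few admissible colours as possible.
choose : List Clause → ℕ
choose cs with units cs
... | []         = least (concatMap proj₂ cs)
... | us@(_ ∷ _) with forced us
...   | []         = least (map proj₂ us)
...   | vs@(_ ∷ _) = least vs

mutual
  -- The number is fuel bounding the depth of the search.
  refute : ℕ → List Clause → Bool
  refute zero    cs = any (null ∘ proj₂) cs
  refute (suc n) cs = any (null ∘ proj₂) cs ∨ branch n (choose cs) cs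

  branch : ℕ → ℕ → List Clause → Bool
  branch n v cs = all (λ d → refute n (assign v d cs)) (allFin 3)

empty-clause-sound : ∀ {χ} cs → T (any (null ∘ proj₂) cs) → ¬ Satisfies χ cs
empty-clause-sound ((c , [])    ∷ cs) _ (s ∷ _)  = s []
empty-clause-sound ((c , _ ∷ _) ∷ cs) t (_ ∷ ss) = empty-clause-sound cs t ss

-- Any branching vertex is sound: the branch for its actual colour `χ v` preserves satisfaction.
refute-sound : ∀ {χ} n cs → T (refute n cs) → ¬ Satisfies χ cs
refute-sound zero    cs t = empty-clause-sound cs t
refute-sound {χ} (suc n) cs t ss with Equivalence.to T-∨ t
... | inj₁ e = empty-clause-sound cs e ss
... | inj₂ b = refute-sound n (assign v (χ v) cs)
                 (All.lookup (All.all⁺ (λ d → refute n (assign v d cs)) (allFin 3) b) (∈-allFin (χ v)))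
                 (assign-sound refl ss)
  where v = choose cs

-- For `a ≢ b`, the permutation of the colours that takes `a` to 0 and `b` to 1.
recolour : Colour → Colour → Colour → Colour
recolour a b c = if does (c Fin.≟ a) then zero else if does (c Fin.≟ b) then suc zero else suc (suc zero)

recolour-spec : ∀ a b → a ≢ b →
  recolour a b a ≡ zero × recolour a b b ≡ suc zero × (∀ c d → recolour a b c ≡ recolour a b d → c ≡ d)
recolour-spec = from-yes (Fin.all? λ a → Fin.all? λ b → ¬? (a Fin.≟ b) →-dec
  (recolour a b a Fin.≟ zero ×-dec recolour a b b Fin.≟ suc zero ×-dec
   Fin.all? λ c → Fin.all? λ d → (recolour a b c Fin.≟ recolour a b d) →-dec (c Fin.≟ d)))

-- The solution (k − |extras|) · bulk + Σ extras = target
record Edge : Set where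
  constructor edge
  field
    bulk   : ℕ
    extras : List ℕ
    target : ℕ

Mono : (ℕ → Colour) → Edge → Set
Mono χ (edge v us y) = All (λ i → χ i ≡ χ y) (v ∷ us)

mono? : ∀ χ e → Dec (Mono χ e)
mono? χ (edge v us y) = All.all? (λ i → χ i Fin.≟ χ y) (v ∷ us)

clausesOf : Edge → List Clause
clausesOf (edge v us y) = map (λ c → c , y ∷ v ∷ us) (allFin 3)

clauses-sound : ∀ χ es → ¬ Any (Mono χ) es → Satisfies χ (concatMap clausesOf es)
clauses-sound χ []                  _  = []
clauses-sound χ (edge v us y ∷ es) no-mono =
  All.++⁺ (All.map⁺ {f = λ c → c , y ∷ v ∷ us} (All.universal (λ _ → not-all) (allFin 3)))
          (clauses-sound χ es (no-mono ∘ there))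
  where
  not-all : ∀ {c} → ¬ All (λ i → χ i ≡ c) (y ∷ v ∷ us)
  not-all (refl ∷ same) = no-mono (here same)

-- By symmetry of the colours, vertices 0 and 1 may be assumed to have colours 0 and 1.
monochromatic-edge : ∀ {n} es →
  T (refute n (assign 1 (suc zero) (assign 0 zero (concatMap clausesOf es)))) →
  ∀ χ → χ 0 ≢ χ 1 → Any (Mono χ) es
monochromatic-edge {n} es t χ χ0≢χ1 with Any.any? (mono? χ) es
... | yes e = e
... | no ne with recolour-spec (χ 0) (χ 1) χ0≢χ1
...   | 0↦ , 1↦ , injective = contradiction
  (assign-sound 1↦ (assign-sound 0↦ (clauses-sound (recolour (χ 0) (χ 1) ∘ χ) es
    -- Recolouring is injective, so an edge monochromatic afterwards was so before.
    (ne ∘ Any.map (All.map (injective _ _))))))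
  (refute-sound n _ t)

-- Vertices are sets of positions in a fixed list of factors; the weight of a vertex is
-- the product of its factors, and it stands for the number (product of all factors) / weight.
-- All factors are polynomials in m = k − 2.
module Vertices (factors : List Poly) (vertices : List (List ℕ)) where

  weightOf coweightOf : List ℕ → Poly
  weightOf   is = Π (select (λ i → any (i ≡ᵇ_) is) factors)
  coweightOf is = Π (select (λ i → not (any (i ≡ᵇ_) is)) factors)

  vertex : ℕ → List ℕ
  vertex i = fromMaybe [] (head (drop i vertices))

  weight : ℕ → Poly
  weight i = weightOf (vertex i)

  total : ℕ → ℕ
  total = ⟦ Π factors ⟧

  -- As `m = k − 2`, the linear polynomial is `k` minus the number of extras; truncated subtraction
  -- is exact for at most two extras.
  bulk+extras : Poly → List Poly → Poly
  bulk+extras p qs = foldr _⊕_ ((2 ∸ length qs ∷ 1 ∷ []) ⊗ p) qs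

  -- Equality of coefficient lists is decidable and gives the identity for all `k` at once.
  Valid : Edge → Set
  Valid (edge v us y) = length us ≤ 2 × bulk+extras (weight v) (map weight us) ≡ weight y

  valid? : ∀ e → Dec (Valid e)
  valid? (edge v us y) = length us ≤? 2 ×-dec List.≡-dec _≟_ (bulk+extras (weight v) (map weight us)) (weight y)

  -- The vertices and their weights are passed as an argument so that evaluation shares them.
  edgesAmong : List (ℕ × Poly) → List Edge
  edgesAmong vs = concatMap edgesAt vs
    where
    extras : List (ℕ × Poly) → List (List (ℕ × Poly))
    extras []       = []
    extras (u ∷ us) = (u ∷ []) ∷ map (λ w → u ∷ w ∷ []) (u ∷ us) ++ extras us

    withWeight : Poly → List (ℕ × Poly)
    withWeight p = filterᵇ (λ (_ , q) → does (List.≡-dec _≟_ q p)) vs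

    edgesAt : ℕ × Poly → List Edge
    edgesAt (v , p) = concatMap
      (λ us → map (λ (y , _) → edge v (map proj₁ us) y) (withWeight (bulk+extras p (map proj₂ us))))
      -- Extras may repeat but avoid `v`: an extra equal to `v` would only enlarge the bulk.
      ([] ∷ extras (filterᵇ (λ (u , _) → not (u ≡ᵇ v)) vs))

  edges : List Edge
  edges = edgesAmong (zip (upTo (length vertices)) (map weightOf vertices))

  -- Every edge is validated again here, so its generation needs no correctness proof.
  all-valid uncolourable check : List Edge → Bool
  all-valid    es = ⌊ All.all? valid? es ⌋
  uncolourable es = refute (length vertices) (assign 1 (suc zero) (assign 0 zero (concatMap clausesOf es)))
  check        es = all-valid es ∧ uncolourable es

  -- From valid edges to solutions in reciprocals

  module _ (total-positive : 1 ≤ total 0) (m : ℕ) where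

    coweight : ℕ → ℕ
    coweight i = ⟦ coweightOf (vertex i) ⟧ m

    weight*coweight : ∀ i → ⟦ weight i ⟧ m * coweight i ≡ total m
    weight*coweight i = ⟦⟧-select _ factors m

    instance
      total≢0 : NonZero (total m)
      total≢0 = ℕ.>-nonZero (≤-trans total-positive (⟦⟧-mono (Π factors) z≤n))

    weight*coweight≢0 : ∀ i → NonZero (⟦ weight i ⟧ m * coweight i)
    weight*coweight≢0 i = subst NonZero (sym (weight*coweight i)) total≢0

    weight≢0 : ∀ i → NonZero (⟦ weight i ⟧ m)
    weight≢0 i = m*n≢0⇒m≢0 (⟦ weight i ⟧ m) {{weight*coweight≢0 i}}

    coweight≢0 : ∀ i → NonZero (coweight i)
    coweight≢0 i = m*n≢0⇒n≢0 (⟦ weight i ⟧ m) {{weight*coweight≢0 i}}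

    coweight≤total : ∀ i → coweight i ≤ total m
    coweight≤total i = subst (coweight i ≤_) (weight*coweight i) (m≤n*m (coweight i) (⟦ weight i ⟧ m) {{weight≢0 i}})

    pred-coweight<total : ∀ i → ℕ.pred (coweight i) < total m
    pred-coweight<total i = subst (_≤ total m) (sym (suc-pred (coweight i) {{coweight≢0 i}})) (coweight≤total i)

    number : ℕ → Fin (total m)
    number i = fromℕ< (pred-coweight<total i)

    weight*number : ∀ i → ⟦ weight i ⟧ m * elem (number i) ≡ suc (ℕ.pred (total m))
    weight*number i = begin
      ⟦ weight i ⟧ m * elem (number i)
        ≡⟨ cong (λ t → ⟦ weight i ⟧ m * suc t) (Fin.toℕ-fromℕ< (pred-coweight<total i)) ⟩
      ⟦ weight i ⟧ m * suc (ℕ.pred (coweight i))  ≡⟨ cong (⟦ weight i ⟧ m *_) (suc-pred (coweight i) {{coweight≢0 i}}) ⟩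
      ⟦ weight i ⟧ m * coweight i                 ≡⟨ weight*coweight i ⟩
      total m                                     ≡⟨ suc-pred (total m) ⟨
      suc (ℕ.pred (total m))                      ∎
      where open ≡-Reasoning

    edge-solution : ∀ (Δ : Fin (total m) → Colour) e → Valid e → Mono (Δ ∘ number) e →
      HasMonoSolution (2 + m) (total m) Δ
    edge-solution Δ (edge v us y) (us≤2 , balanced) (v-same ∷ us-same) =
      subst (λ k → HasMonoSolution k (total m) Δ) length≡
        (monochromatic num number weight*number Δ is y sum≡ (All.++⁺ (All.replicate⁺ b v-same) us-same))
      where
      open ≡-Reasoning
      num = λ i → ⟦ weight i ⟧ m
      b = 2 ∸ length us + m
      is = replicate b v ++ us

      length≡ : length is ≡ 2 + m
      length≡ = begin
        length is                         ≡⟨ List.length-++ (replicate b v) ⟩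
        length (replicate b v) + length us ≡⟨ cong (_+ length us) (List.length-replicate b) ⟩
        2 ∸ length us + m + length us     ≡⟨ lemma (2 ∸ length us) m (length us) ⟩
        2 ∸ length us + length us + m     ≡⟨ cong (_+ m) (m∸n+n≡m us≤2) ⟩
        2 + m                             ∎
        where
        lemma : ∀ a b c → a + b + c ≡ a + c + b
        lemma = solve-∀

      ws = map weight us
      Σws = sum (map (λ q → ⟦ q ⟧ m) ws)

      sum≡ : sum (map num is) ≡ num y
      sum≡ = begin
        sum (map num is)
          ≡⟨ cong sum (List.map-++ num (replicate b v) us) ⟩
        sum (map num (replicate b v) ++ map num us)
          ≡⟨ sum-++ (map num (replicate b v)) (map num us) ⟩
        sum (map num (replicate b v)) + sum (map num us)
          ≡⟨ cong₂ _+_ (sum-map-replicate num b v) (cong sum (List.map-∘ us)) ⟩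
        b * num v + Σws
          ≡⟨ cong (λ c → c * num v + Σws) (lemma (2 ∸ length us) m) ⟩
        ⟦ 2 ∸ length us ∷ 1 ∷ [] ⟧ m * num v + Σws
          ≡⟨ cong (_+ Σws) (⟦⟧-⊗ (2 ∸ length us ∷ 1 ∷ []) (weight v) m) ⟨
        ⟦ (2 ∸ length us ∷ 1 ∷ []) ⊗ weight v ⟧ m + Σws
          ≡⟨ cong (λ l → ⟦ (2 ∸ l ∷ 1 ∷ []) ⊗ weight v ⟧ m + Σws) (List.length-map weight us) ⟨
        ⟦ (2 ∸ length ws ∷ 1 ∷ []) ⊗ weight v ⟧ m + Σws
          ≡⟨ ⟦⟧-foldr-⊕ ((2 ∸ length ws ∷ 1 ∷ []) ⊗ weight v) ws m ⟨
        ⟦ bulk+extras (weight v) ws ⟧ m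
          ≡⟨ cong (λ p → ⟦ p ⟧ m) balanced ⟩
        num y ∎
        where
        lemma : ∀ a m → a + m ≡ a + m * (1 + m * 0)
        lemma = solve-∀

    -- If vertices 0 and 1 share a colour, `k` copies of the first give the second; otherwise the
    -- refuted search supplies an edge.
    arrows : ∀ es → check es ≡ true → Valid (edge 0 [] 1) → Arrows 3 (2 + m) (total m)
    arrows es checked 0→1 Δ with Δ (number 0) Fin.≟ Δ (number 1)
    ... | yes same   = edge-solution Δ (edge 0 [] 1) 0→1 (same ∷ [])
    ... | no  differ = edge-solution Δ (Any.lookup mono-edge) (proj₁ valid,mono) (proj₂ valid,mono)
      where
      valid∧uncolourable : T (all-valid es) × T (uncolourable es)
      valid∧uncolourable = Equivalence.to (T-∧ {all-valid es} {uncolourable es}) (Equivalence.from T-≡ checked)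
      mono-edge : Any (Mono (Δ ∘ number)) es
      mono-edge = monochromatic-edge {length vertices} es (proj₂ valid∧uncolourable) (Δ ∘ number) differ
      valid,mono : Valid (Any.lookup mono-edge) × Mono (Δ ∘ number) (Any.lookup mono-edge)
      valid,mono = All.lookupAny (toWitness {a? = All.all? valid? es} (proj₁ valid∧uncolourable)) mono-edge

  bound : 1 ≤ total 0 → length (Π factors) ≤ 43 → check edges ≡ true → Valid (edge 0 [] 1) →
    ∀ k → 2 ≤ k → f≤ 3 k (sum (Π factors) * k ^ 43)
  bound positive degree checked 0→1 k 2≤k =
    total m , total≤ , subst (λ k → Arrows 3 k (total m)) (m+[n∸m]≡n 2≤k) (arrows positive m edges checked 0→1)
    where
    m = k ∸ 2
    instance
      k≢0 : NonZero k
      k≢0 = ℕ.>-nonZero (≤-trans (s≤s z≤n) 2≤k)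
    total≤ : total m ≤ sum (Π factors) * k ^ 43
    total≤ = ≤-trans (⟦⟧-bound (Π factors) (m∸n≤m k 2)) (*-monoʳ-≤ (sum (Π factors)) (^-monoʳ-≤ k degree))

-- Factors of an lcm of the vertices, as polynomials in k = m + 2, with a position for each occurrence.
factors : List Poly
factors =
    (2 ∷ [])                   --  0: 2
  ∷ (2 ∷ 1 ∷ [])               --  1: k
  ∷ (2 ∷ 1 ∷ [])               --  2: k
  ∷ (2 ∷ 1 ∷ [])               --  3: k
  ∷ (3 ∷ 1 ∷ [])               --  4: k + 1
  ∷ (3 ∷ 1 ∷ [])               --  5: k + 1
  ∷ (1 ∷ 1 ∷ [])               --  6: k − 1
  ∷ (5 ∷ 3 ∷ [])               --  7: 3k − 1
  ∷ (3 ∷ 2 ∷ [])               --  8: 2k − 1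
  ∷ (4 ∷ 1 ∷ [])               --  9: k + 2
  ∷ (5 ∷ 4 ∷ 1 ∷ [])           -- 10: k² + 1
  ∷ (7 ∷ 5 ∷ 1 ∷ [])           -- 11: k² + k + 1
  ∷ (7 ∷ 6 ∷ 1 ∷ [])           -- 12: k² + 2k − 1
  ∷ (3 ∷ 3 ∷ 1 ∷ [])           -- 13: k² − k + 1
  ∷ (4 ∷ 3 ∷ 1 ∷ [])           -- 14: k² − k + 2
  ∷ (5 ∷ 5 ∷ 1 ∷ [])           -- 15: k² + k − 1
  ∷ (11 ∷ 15 ∷ 7 ∷ 1 ∷ [])     -- 16: k³ + k² − k + 1
  ∷ (11 ∷ 14 ∷ 6 ∷ 1 ∷ [])     -- 17: k³ + 2k − 1
  ∷ (13 ∷ 17 ∷ 7 ∷ 1 ∷ [])     -- 18: k³ + k² + k − 1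
  ∷ []

-- Found by computer search; the order steers the branching of refute.
vertices : List (List ℕ)
vertices =
    []                         -- 1
  ∷ (1 ∷ [])                   -- k
  ∷ (1 ∷ 4 ∷ [])               -- k(k + 1)
  ∷ (1 ∷ 10 ∷ [])              -- k(k² + 1)
  ∷ (0 ∷ 1 ∷ [])               -- 2k
  ∷ (4 ∷ [])
  ∷ (11 ∷ [])
  ∷ (1 ∷ 2 ∷ 4 ∷ [])           -- k²(k + 1)
  ∷ (12 ∷ [])
  ∷ (16 ∷ [])
  ∷ (0 ∷ 1 ∷ 2 ∷ [])           -- 2k²
  ∷ (6 ∷ [])
  ∷ (7 ∷ [])
  ∷ (1 ∷ 12 ∷ [])              -- k(k² + 2k − 1)
  ∷ (4 ∷ 13 ∷ [])              -- k³ + 1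
  ∷ (0 ∷ [])
  ∷ (4 ∷ 5 ∷ [])               -- (k + 1)²
  ∷ (4 ∷ 8 ∷ [])               -- (k + 1)(2k − 1)
  ∷ (1 ∷ 9 ∷ [])               -- k(k + 2)
  ∷ (10 ∷ [])
  ∷ (14 ∷ [])
  ∷ (15 ∷ [])
  ∷ (1 ∷ 7 ∷ [])               -- k(3k − 1)
  ∷ (4 ∷ 15 ∷ [])              -- (k + 1)(k² + k − 1)
  ∷ (1 ∷ 2 ∷ [])               -- k²
  ∷ (17 ∷ [])
  ∷ (18 ∷ [])
  ∷ (0 ∷ 1 ∷ 2 ∷ 3 ∷ [])       -- 2k³
  ∷ []

open Vertices factors vertices

-- By evaluation: the type checker generates the edges, validates them and runs the refutation.
edges-checked : check edges ≡ true
edges-checked = refl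

theorem5p2 : Σ ℕ λ C → Σ ℕ λ K →
    (k : ℕ) → K ≤ k → 2 ≤ k → f≤ 3 k (C * k ^ 43)
-- The constant is the coefficient sum of the lcm polynomial in `m`; its length 31 is below 43, and
-- the bound holds from `k = 2` on.
theorem5p2 = sum (Π factors) , 0 , λ k _ →
  bound (toWitness {a? = 1 ≤? total 0} _) (toWitness {a? = length (Π factors) ≤? 43} _)
        edges-checked (toWitness {a? = valid? (edge 0 [] 1)} _) k
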